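{- Let $n\ge 2$ and let $P_n$ be the path on $n$ vertices. Then $$\tau(P_n)=\begin{cases}1 & \text{if } n\equiv 0 \pmod 4,\\ \lfloor n/4\rfloor & \text{if } n\equiv 1 \pmod 4,\\ (\lfloor n/4\rfloor+1)^2 & \text{if } n\equiv 2 \pmod 4,\\ \lfloor n/4\rfloor+2 & \text{if } n\equiv 3 \pmod 4.\end{cases}$$
   Context: A set $D \subseteq V(G)$ is a total dominating set of a graph $G$ if every vertex of $G$ has a neighbor in $D$. $\gamma_t(G)$ is the minimum cardinality of a total dominating set; a minimum one is a $\gamma_t(G)$-set, and $\tau(G)$ is the number of $\gamma_t(G)$-sets. -}

module Defs where

open import Data.Fin.Base using (Fin; toℕ)
open import Data.Fin.Properties using (all?; any?)
open import Data.Fin.Subset using (Subset; inside; outside; _∈_; ∣_∣)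
open import Data.Fin.Subset.Properties using (_∈?_; anySubset?)
open import Data.List.Base using (List; []; _∷_; _++_; map; filter; length)
open import Data.List.Membership.Propositional using () renaming (_∈_ to _∈ˡ_)
open import Data.List.Membership.Propositional.Properties
  using (∈-map⁺; ∈-map⁻; ∈-++⁺ˡ; ∈-++⁺ʳ)
open import Data.List.Relation.Unary.All using () renaming ([] to []ᵃ)
open import Data.List.Relation.Unary.Any using (here)
open import Data.List.Relation.Unary.Unique.Propositional using (Unique; []; _∷_)
open import Data.List.Relation.Unary.Unique.Propositional.Properties using (map⁺; ++⁺)
open import Data.Nat.Base using (ℕ; zero; suc; _≤_)
open import Data.Nat.Properties using (_≟_; _≤?_; 1+n≢n)
open import Data.Product.Base using (∃-syntax; _×_; _,_)
open import Data.Sum.Base using (_⊎_; inj₁; inj₂; swap)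
open import Data.Vec.Base using ([]; _∷_)
open import Data.Vec.Properties using (∷-injectiveʳ)
open import Relation.Binary.Core using (Rel)
open import Relation.Binary.Definitions using (Decidable; Irreflexive; Symmetric)
open import Relation.Binary.PropositionalEquality using (_≡_; refl; sym)
open import Relation.Nullary using (Dec; yes; no; ¬_)
open import Relation.Nullary.Decidable
  using (_×-dec_; _⊎-dec_; _→-dec_; ¬?; decidable-stable)
open import Level using (0ℓ)

-- Adjacency is required to be decidable so that the sets below can be counted.
record Graph (n : ℕ) : Set₁ where
  field
    Adj    : Rel (Fin n) 0ℓ
    adj?   : Decidable Adj
    symm   : Symmetric Adj
    irrefl : Irreflexive _≡_ Adj

path : ∀ n → Graph n
path n = record
  { Adj    = λ i j → toℕ j ≡ suc (toℕ i) ⊎ toℕ i ≡ suc (toℕ j)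
  ; adj?   = λ i j → (toℕ j ≟ suc (toℕ i)) ⊎-dec (toℕ i ≟ suc (toℕ j))
  ; symm   = swap
  ; irrefl = λ { refl (inj₁ p) → 1+n≢n (sym p) ; refl (inj₂ p) → 1+n≢n (sym p) }
  }

subsets : ∀ n → List (Subset n)
subsets zero    = [] ∷ []
subsets (suc n) = map (inside ∷_) (subsets n) ++ map (outside ∷_) (subsets n)

subsets-complete : ∀ {n} (D : Subset n) → D ∈ˡ subsets n
subsets-complete []            = here refl
subsets-complete (inside  ∷ D) = ∈-++⁺ˡ (∈-map⁺ (inside ∷_) (subsets-complete D))
subsets-complete {suc n} (outside ∷ D) =
  ∈-++⁺ʳ (map (inside ∷_) (subsets n)) (∈-map⁺ (outside ∷_) (subsets-complete D))

subsets-unique : ∀ n → Unique (subsets n)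
subsets-unique zero    = []ᵃ ∷ []
subsets-unique (suc n) =
  ++⁺ (map⁺ ∷-injectiveʳ (subsets-unique n)) (map⁺ ∷-injectiveʳ (subsets-unique n)) disjoint
  where
  disjoint : ∀ {D} → ¬ (D ∈ˡ map (inside ∷_) (subsets n) × D ∈ˡ map (outside ∷_) (subsets n))
  disjoint (p , q) with ∈-map⁻ (inside ∷_) p | ∈-map⁻ (outside ∷_) q
  ... | _ , _ , refl | _ , _ , ()

module _ {n} (G : Graph n) where
  open Graph G

  TotalDominating : Subset n → Set
  TotalDominating D = ∀ v → ∃[ u ] (u ∈ D × Adj v u)

  totalDominating? : ∀ D → Dec (TotalDominating D)
  totalDominating? D = all? λ v → any? λ u → (u ∈? D) ×-dec adj? v u

  IsγₜSet : Subset n → Set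
  IsγₜSet D = TotalDominating D × (∀ D′ → TotalDominating D′ → ∣ D ∣ ≤ ∣ D′ ∣)

  isγₜSet? : ∀ D → Dec (IsγₜSet D)
  isγₜSet? D = totalDominating? D ×-dec minimum?
    where
    smaller? : ∀ D′ → Dec (TotalDominating D′ → ∣ D ∣ ≤ ∣ D′ ∣)
    smaller? D′ = totalDominating? D′ →-dec (∣ D ∣ ≤? ∣ D′ ∣)

    minimum? : Dec (∀ D′ → TotalDominating D′ → ∣ D ∣ ≤ ∣ D′ ∣)
    minimum? with anySubset? (λ D′ → ¬? (smaller? D′))
    ... | yes (D′ , ¬p) = no λ min → ¬p (min D′)
    ... | no  ¬∃        = yes λ D′ → decidable-stable (smaller? D′) λ ¬p → ¬∃ (D′ , ¬p)

  τ : ℕ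
  τ = length (filter isγₜSet? (subsets n))

{-# OPTIONS --safe #-}

-- Reading a subset D of the path from left to right, whether D can still be
-- completed to a total dominating set depends only on the membership of the
-- last two vertices. For each of these four states and each number m of
-- remaining vertices, the minimum size of a completion and the number of
-- completions attaining it are found together, by splitting on the membership
-- of the next vertex and keeping the cheaper branch (or adding the two counts
-- in case of a tie); the closed forms are an induction with step 4 in m.
-- Placing two virtual vertices, a member followed by a non-member, in front of
-- the path imposes no condition on the path itself, so that τ is the count for
-- the state (inside, outside).
module Submission where

open import Defs
open import Data.Bool.Base using (Bool; true; false)
open import Data.Empty using (⊥)
open import Data.Fin.Base using (Fin; zero; suc)
open import Data.Fin.Subset using (Subset; inside; outside; _∈_; ∣_∣)
open import Data.Fin.Subset.Properties using (drop-there)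
open import Data.List.Base using ([]; _∷_; _++_; map; filter; length)
open import Data.List.Membership.Propositional.Properties using (∈-filter⁻)
open import Data.List.Properties using (filter-++; filter-none; filter-≐; length-++)
open import Data.List.Relation.Unary.All using (universal)
open import Data.List.Relation.Unary.Any using (here)
open import Data.Nat using (ℕ; zero; suc; _+_; _*_; _^_; _/_; _%_; _≤_; _<_; z≤n; s≤s)
open import Data.Nat.DivMod using (m≡m%n+[m/n]*n)
open import Data.Nat.Properties
  using (_≟_; ≤-refl; ≤-trans; ≤-antisym; m≤n⇒m≤1+n; <⇒≢; suc-injective; +-comm; *-suc; *-identityʳ)
open import Data.Product using (∃-syntax; _×_; _,_; proj₁; proj₂)
open import Data.Sum using (inj₁; inj₂) renaming (map to map⊎)
open import Data.Unit using (⊤; tt)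
open import Data.Vec.Base using ([]; _∷_; here; there)
open import Function using (_∘_)
open import Level using (0ℓ)
open import Relation.Binary.PropositionalEquality
  using (_≡_; refl; sym; trans; cong; cong₂; subst; module ≡-Reasoning)
open import Relation.Nullary using (yes; no; ¬_; does; contradiction)
open import Relation.Nullary.Decidable using (_×-dec_)
open import Relation.Unary using (Pred; Decidable; _≐_)

-- Counting subsets by their first entry.

count : ∀ {m} {P : Pred (Subset m) 0ℓ} → Decidable P → ℕ
count {m} P? = length (filter P? (subsets m))

module _ {A B : Set} {P : Pred B 0ℓ} (P? : Decidable P) (f : A → B) where

  length-filter-map : ∀ xs → length (filter P? (map f xs)) ≡ length (filter (P? ∘ f) xs)
  length-filter-map []       = refl
  length-filter-map (x ∷ xs) with does (P? (f x))
  ... | true  = cong suc (length-filter-map xs)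
  ... | false = length-filter-map xs

module _ {m} {P : Pred (Subset m) 0ℓ} (P? : Decidable P) where

  count-≐ : ∀ {Q : Pred (Subset m) 0ℓ} (Q? : Decidable Q) → P ≐ Q → count P? ≡ count Q?
  count-≐ Q? P≐Q = cong length (filter-≐ P? Q? P≐Q (subsets m))

  count-empty : (∀ D → ¬ P D) → count P? ≡ 0
  count-empty ¬P = cong length (filter-none P? (universal ¬P (subsets m)))

  count-witness : 0 < count P? → ∃[ D ] P D
  count-witness 0<count with filter P? (subsets m) | (λ {D} → ∈-filter⁻ P? {v = D} {xs = subsets m})
  count-witness ()      | []    | _
  ... | D ∷ _ | ∈⇒P = D , proj₂ (∈⇒P (here refl))

count-∷ : ∀ {m} {P : Pred (Subset (suc m)) 0ℓ} (P? : Decidable P) →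
  count P? ≡ count (P? ∘ (inside ∷_)) + count (P? ∘ (outside ∷_))
count-∷ {m} P? = begin
  length (filter P? (ins ++ outs))
    ≡⟨ cong length (filter-++ P? ins outs) ⟩
  length (filter P? ins ++ filter P? outs)
    ≡⟨ length-++ (filter P? ins) ⟩
  length (filter P? ins) + length (filter P? outs)
    ≡⟨ cong₂ _+_ (length-filter-map P? (inside ∷_) (subsets m))
                 (length-filter-map P? (outside ∷_) (subsets m)) ⟩
  count (P? ∘ (inside ∷_)) + count (P? ∘ (outside ∷_)) ∎
  where
  open ≡-Reasoning
  ins  = map (inside ∷_) (subsets m)
  outs = map (outside ∷_) (subsets m)

-- Minimum size and its multiplicity.

OfSize? : ∀ {m} {P : Pred (Subset m) 0ℓ} → Decidable P → (k : ℕ) →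
  Decidable (λ D → P D × ∣ D ∣ ≡ k)
OfSize? P? k D = P? D ×-dec ∣ D ∣ ≟ k

-- When c is 0, the value γ is only a lower bound and need not be attained.
record Minima {m} {P : Pred (Subset m) 0ℓ} (P? : Decidable P) (γ c : ℕ) : Set where
  field
    bound  : ∀ D → P D → γ ≤ ∣ D ∣
    number : count (OfSize? P? γ) ≡ c

open Minima

module _ {m} {P : Pred (Subset (suc m)) 0ℓ} {P? : Decidable P} where
  private
    P?ᵢ = P? ∘ (inside ∷_)
    P?ₒ = P? ∘ (outside ∷_)

  number-inside : ∀ {γ c} → Minima P?ᵢ γ c → count (OfSize? P? (suc γ) ∘ (inside ∷_)) ≡ c
  number-inside {γ} μ = trans
    (count-≐ (OfSize? P? (suc γ) ∘ (inside ∷_)) (OfSize? P?ᵢ γ)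
      ((λ (p , e) → p , suc-injective e) , (λ (p , e) → p , cong suc e)))
    (number μ)

  -- Taking the first vertex costs one, so an inside minimum `γ` ties with an outside minimum
  -- `suc γ`. A branch of count 0 contributes only a lower bound, which suffices.
  Minima-tie : ∀ {γ c c′} → Minima P?ᵢ γ c → Minima P?ₒ (suc γ) c′ → Minima P? (suc γ) (c + c′)
  Minima-tie μ ν .bound (inside  ∷ D) p = s≤s (bound μ D p)
  Minima-tie μ ν .bound (outside ∷ D) p = bound ν D p
  Minima-tie {γ} μ ν .number =
    trans (count-∷ (OfSize? P? (suc γ))) (cong₂ _+_ (number-inside μ) (number ν))

  Minima-inside : ∀ {γ c} → Minima P?ᵢ γ c → (∀ D → ¬ P (outside ∷ D)) → Minima P? (suc γ) c
  Minima-inside μ ¬P .bound (inside  ∷ D) p = s≤s (bound μ D p)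
  Minima-inside μ ¬P .bound (outside ∷ D) p = contradiction p (¬P D)
  Minima-inside {γ} {c} μ ¬P .number = begin
    count (OfSize? P? (suc γ))
      ≡⟨ count-∷ (OfSize? P? (suc γ)) ⟩
    count (OfSize? P? (suc γ) ∘ (inside ∷_)) + count (OfSize? P?ₒ (suc γ))
      ≡⟨ cong₂ _+_ (number-inside μ) (count-empty (OfSize? P?ₒ (suc γ)) (λ D → ¬P D ∘ proj₁)) ⟩
    c + 0
      ≡⟨ +-comm c 0 ⟩
    c ∎
    where open ≡-Reasoning

  -- Every set containing the first vertex has size at least `suc γ`, which exceeds `γ′`, so only
  -- the outside branch can attain `γ′`.
  Minima-outside : ∀ {γ γ′ c c′} → Minima P?ᵢ γ c → Minima P?ₒ γ′ c′ → γ′ ≤ γ → Minima P? γ′ c′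
  Minima-outside μ ν γ′≤γ .bound (inside  ∷ D) p = m≤n⇒m≤1+n (≤-trans γ′≤γ (bound μ D p))
  Minima-outside μ ν γ′≤γ .bound (outside ∷ D) p = bound ν D p
  Minima-outside {γ} {γ′} μ ν γ′≤γ .number = trans
    (count-∷ (OfSize? P? γ′))
    (cong₂ _+_
      (count-empty (OfSize? P? γ′ ∘ (inside ∷_))
        (λ D (p , e) → <⇒≢ (s≤s (≤-trans γ′≤γ (bound μ D p))) (sym e)))
      (number ν))

-- D is appended to two vertices whose membership is a and b; every vertex from
-- the second of these two onwards has to be dominated.
Completes : Bool → Bool → ∀ {m} → Pred (Subset m) 0ℓ
Completes true  b []            = ⊤
Completes false b []            = ⊥
Completes true  b (x ∷ D)       = Completes b x D
Completes false b (inside  ∷ D) = Completes b inside D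
Completes false b (outside ∷ D) = ⊥

completes? : ∀ a b {m} → Decidable (Completes a b {m})
completes? true  b []            = yes tt
completes? false b []            = no λ ()
completes? true  b (x ∷ D)       = completes? b x D
completes? false b (inside  ∷ D) = completes? b inside D
completes? false b (outside ∷ D) = no λ ()

-- Closed forms for the four states.

CompletionMinima : Bool → Bool → (m γ c : ℕ) → Set
CompletionMinima a b m = Minima (completes? a b {m})

-- When the vertex before the last one is not a member, the last one can only be dominated by the
-- next vertex.
forced : ∀ {b m γ c} → CompletionMinima b true m γ c → CompletionMinima false b (suc m) (suc γ) c
forced μ = Minima-inside μ λ D ()

-- The suffix of each name is the residue of the number of remaining vertices.
mutual
  tt₀ : ∀ q → CompletionMinima true true (q * 4) (q * 2) (suc q)
  tt₀ zero    = record { bound = λ _ _ → z≤n ; number = refl }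
  tt₀ (suc q) = Minima-outside (tt₃ q) (tf₃ q) ≤-refl

  tf₀ : ∀ q → CompletionMinima true false (q * 4) (q * 2) 1
  tf₀ zero    = record { bound = λ _ _ → z≤n ; number = refl }
  tf₀ (suc q) = Minima-outside (ft₃ q) (ff₃ q) ≤-refl

  ft₀ : ∀ q → CompletionMinima false true (q * 4) (1 + q * 2) (q * suc q)
  -- There is no completion, so any bound holds vacuously; 1 is the value of the closed form at
  -- `q = 0`.
  ft₀ zero    = record { bound = λ { [] () } ; number = refl }
  ft₀ (suc q) = forced (tt₃ q)

  ff₀ : ∀ q → CompletionMinima false false (q * 4) (1 + q * 2) q
  ff₀ zero    = record { bound = λ { [] () } ; number = refl }
  ff₀ (suc q) = forced (ft₃ q)

  tt₁ : ∀ q → CompletionMinima true true (1 + q * 4) (q * 2) 1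
  tt₁ q = Minima-outside (tt₀ q) (tf₀ q) ≤-refl

  tf₁ : ∀ q → CompletionMinima true false (1 + q * 4) (1 + q * 2) q
  tf₁ q = Minima-outside (ft₀ q) (ff₀ q) ≤-refl

  ft₁ : ∀ q → CompletionMinima false true (1 + q * 4) (1 + q * 2) (suc q)
  ft₁ q = forced (tt₀ q)

  ff₁ : ∀ q → CompletionMinima false false (1 + q * 4) (2 + q * 2) (q * suc q)
  ff₁ q = forced (ft₀ q)

  tt₂ : ∀ q → CompletionMinima true true (2 + q * 4) (1 + q * 2) (suc q)
  tt₂ q = Minima-tie (tt₁ q) (tf₁ q)

  tf₂ : ∀ q → CompletionMinima true false (2 + q * 4) (2 + q * 2) (suc q * suc q)
  -- The square arises as `suc q + q * suc q`, which is `suc q * suc q` by definition.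
  tf₂ q = Minima-tie (ft₁ q) (ff₁ q)

  ft₂ : ∀ q → CompletionMinima false true (2 + q * 4) (1 + q * 2) 1
  ft₂ q = forced (tt₁ q)

  ff₂ : ∀ q → CompletionMinima false false (2 + q * 4) (2 + q * 2) (suc q)
  ff₂ q = forced (ft₁ q)

  tt₃ : ∀ q → CompletionMinima true true (3 + q * 4) (2 + q * 2) (suc q * suc (suc q))
  -- The tie yields `suc q + suc q * suc q`, here factored as a product.
  tt₃ q = subst (CompletionMinima true true (3 + q * 4) (2 + q * 2))
    (sym (*-suc (suc q) (suc q))) (Minima-tie (tt₂ q) (tf₂ q))

  tf₃ : ∀ q → CompletionMinima true false (3 + q * 4) (2 + q * 2) (suc (suc q))
  tf₃ q = Minima-tie (ft₂ q) (ff₂ q)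

  ft₃ : ∀ q → CompletionMinima false true (3 + q * 4) (2 + q * 2) (suc q)
  ft₃ q = forced (tt₂ q)

  ff₃ : ∀ q → CompletionMinima false false (3 + q * 4) (2 + q * 2) 1
  ff₃ q = forced (ft₂ q)

-- Completions as total dominating sets.

Dominated : ∀ {n} → Subset n → Fin n → Set
Dominated {n} D v = ∃[ u ] (u ∈ D × Graph.Adj (path n) v u)

module _ {n} {D : Subset n} where

  dominated-suc : ∀ {x v} → Dominated D v → Dominated (x ∷ D) (suc v)
  dominated-suc (u , u∈D , adj) = suc u , there u∈D , map⊎ (cong suc) (cong suc) adj

  dominated-pred : ∀ {x v} → ¬ Graph.Adj (path (suc n)) (suc v) zero →
    Dominated (x ∷ D) (suc v) → Dominated D v
  dominated-pred ¬adj (zero  , _   , adj) = contradiction adj ¬adj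
  dominated-pred _    (suc u , u∈D , adj) =
    u , drop-there u∈D , map⊎ suc-injective suc-injective adj

  dominated-pred-outside : ∀ {v} → Dominated (outside ∷ D) (suc v) → Dominated D v
  dominated-pred-outside (zero  , () , _)
  dominated-pred-outside (suc u , u∈D , adj) =
    u , drop-there u∈D , map⊎ suc-injective suc-injective adj

2+v≁0 : ∀ {n} {v : Fin n} → ¬ Graph.Adj (path (suc (suc n))) (suc (suc v)) zero
2+v≁0 (inj₁ ())
2+v≁0 (inj₂ ())

-- The second vertex is dominated by the first one if `a` holds and by the head of `D` otherwise;
-- later vertices follow by shifting the two-vertex window by one.
completes⇒dominated : ∀ a b {m} (D : Subset m) → Completes a b D →
  ∀ v → Dominated (a ∷ b ∷ D) (suc v)
completes⇒dominated true  b D             p zero    = zero , here , inj₂ refl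
completes⇒dominated false b (inside ∷ D)  p zero    = suc (suc zero) , there (there here) , inj₁ refl
completes⇒dominated true  b (x ∷ D)       p (suc v) = dominated-suc (completes⇒dominated b x D p v)
completes⇒dominated false b (inside ∷ D)  p (suc v) = dominated-suc (completes⇒dominated b inside D p v)

dominated⇒completes : ∀ a b {m} (D : Subset m) →
  (∀ v → Dominated (a ∷ b ∷ D) (suc v)) → Completes a b D
dominated⇒completes true  b []            dom = tt
dominated⇒completes false b []            dom with dom zero
... | zero     , () , _
... | suc zero , _ , inj₁ ()
... | suc zero , _ , inj₂ ()
dominated⇒completes true  b (x ∷ D)       dom =
  dominated⇒completes b x D (dominated-pred 2+v≁0 ∘ dom ∘ suc)
dominated⇒completes false b (inside  ∷ D) dom =
  dominated⇒completes b inside D (dominated-pred 2+v≁0 ∘ dom ∘ suc)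
-- The only neighbors of the second vertex are the first and the third, both non-members.
dominated⇒completes false b (outside ∷ D) dom with dom zero
... | zero              , ()               , _
... | suc zero          , _                , inj₁ ()
... | suc zero          , _                , inj₂ ()
... | suc (suc zero)    , there (there ()) , _
... | suc (suc (suc _)) , _                , inj₁ ()
... | suc (suc (suc _)) , _                , inj₂ ()

module _ {n} {D : Subset n} where

  completes⇒totalDominating : Completes true false D → TotalDominating (path n) D
  completes⇒totalDominating p v =
    -- The virtual member is adjacent to no vertex of the path, and the virtual non-member dominates
    -- nothing.
    dominated-pred-outside (dominated-pred 2+v≁0 (completes⇒dominated true false D p (suc v)))

  totalDominating⇒completes : TotalDominating (path n) D → Completes true false D
  totalDominating⇒completes td = dominated⇒completes true false D λ where
    -- The virtual non-member is dominated by the virtual member.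
    zero    → zero , here , inj₂ refl
    (suc v) → dominated-suc (dominated-suc (td v))

-- From completions to the values of τ.

τ-path : ∀ {n γ c} → CompletionMinima true false n γ c → 0 < c → τ (path n) ≡ c
τ-path {n} {γ} μ 0<c = trans (count-≐ (isγₜSet? (path n)) minimum? (to , from)) (number μ)
  where
  minimum? = OfSize? (completes? true false) γ

  -- A positive count turns the lower bound `γ` into the total domination number.
  attained : ∃[ D ] (Completes true false D × ∣ D ∣ ≡ γ)
  attained = count-witness minimum? (subst (0 <_) (sym (number μ)) 0<c)

  to : ∀ {D} → IsγₜSet (path n) D → Completes true false D × ∣ D ∣ ≡ γ
  to {D} (td , min) =
    let D₀ , p₀ , ∣D₀∣≡γ = attained
        p = totalDominating⇒completes td
    in p , ≤-antisym (subst (∣ D ∣ ≤_) ∣D₀∣≡γ (min D₀ (completes⇒totalDominating p₀))) (bound μ D p)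

  from : ∀ {D} → Completes true false D × ∣ D ∣ ≡ γ → IsγₜSet (path n) D
  from (p , ∣D∣≡γ) = completes⇒totalDominating p , λ D′ td′ →
    subst (_≤ ∣ D′ ∣) (sym ∣D∣≡γ) (bound μ D′ (totalDominating⇒completes td′))

theorem5p1 : ∀ (n : ℕ) → 2 ≤ n →
    (n % 4 ≡ 0 → τ (path n) ≡ 1)
    × (n % 4 ≡ 1 → τ (path n) ≡ n / 4)
    × (n % 4 ≡ 2 → τ (path n) ≡ (n / 4 + 1) ^ 2)
    × (n % 4 ≡ 3 → τ (path n) ≡ n / 4 + 2)
theorem5p1 n 2≤n = case₀ , case₁ , case₂ , case₃
  where
  q = n / 4

  n≡ : ∀ {r} → n % 4 ≡ r → n ≡ r + q * 4
  n≡ n%4≡r = trans (m≡m%n+[m/n]*n n 4) (cong (_+ q * 4) n%4≡r)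

  minima : ∀ {r γ c} → n % 4 ≡ r → CompletionMinima true false (r + q * 4) γ c →
    CompletionMinima true false n γ c
  minima n%4≡r = subst (λ m → CompletionMinima true false m _ _) (sym (n≡ n%4≡r))

  -- This excludes the path on one vertex, which has no total dominating set.
  0<q : ∀ q → 2 ≤ 1 + q * 4 → 0 < q
  0<q zero    (s≤s ())
  0<q (suc q) _ = s≤s z≤n

  case₀ : n % 4 ≡ 0 → τ (path n) ≡ 1
  case₀ n%4≡0 = τ-path (minima n%4≡0 (tf₀ q)) (s≤s z≤n)

  case₁ : n % 4 ≡ 1 → τ (path n) ≡ q
  case₁ n%4≡1 = τ-path (minima n%4≡1 (tf₁ q)) (0<q q (subst (2 ≤_) (n≡ n%4≡1) 2≤n))

  case₂ : n % 4 ≡ 2 → τ (path n) ≡ (q + 1) ^ 2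
  case₂ n%4≡2 = begin
    τ (path n)     ≡⟨ τ-path (minima n%4≡2 (tf₂ q)) (s≤s z≤n) ⟩
    suc q * suc q  ≡⟨ cong (suc q *_) (*-identityʳ (suc q)) ⟨
    suc q ^ 2      ≡⟨ cong (_^ 2) (+-comm q 1) ⟨
    (q + 1) ^ 2    ∎
    where open ≡-Reasoning

  case₃ : n % 4 ≡ 3 → τ (path n) ≡ q + 2
  case₃ n%4≡3 = trans (τ-path (minima n%4≡3 (tf₃ q)) (s≤s z≤n)) (+-comm 2 q)
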